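{- Let $G$ be a connected graph with maximum degree $\Delta$. Then $\mathrm{vp}^-(G) \geq \left\lceil \frac{\Delta+1}{3} \right\rceil$. If moreover $G$ is bipartite, then $\mathrm{vp}^-(G) \geq \left\lceil \frac{\Delta}{2} \right\rceil$.
   Context: All graphs are finite, undirected and simple. A $u,v$-geodesic is a shortest $u,v$-path. For a vertex $x$ of $G$, a set $S \subseteq V(G)$ is an $x$-position set if for every $y \in S$ no vertex of $S \setminus \{y\}$ lies on any $x,y$-geodesic in $G$. The $x$-position number $p_x(G)$ is the maximum cardinality of an $x$-position set of $G$. The minimum vertex position number is $\mathrm{vp}^-(G) = \min_{x \in V(G)} p_x(G)$. -}

module Defs where

open import Data.Bool.Base using (Bool)
open import Data.Fin.Base using (Fin; zero; suc)
import Data.Fin.Properties as Fin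
open import Data.Fin.Subset using (Subset; inside; outside; _∈_; ∣_∣)
open import Data.Fin.Subset.Properties using (_∈?_)
open import Data.List.Base
  using (List; []; _∷_; length; lookup; map; filter; head; last; allFin; cartesianProductWith)
open import Data.List.Extrema.Nat using (max; min)
open import Data.List.Membership.Propositional using () renaming (_∈_ to _∈ˡ_; _∉_ to _∉ˡ_)
import Data.List.Membership.DecPropositional as DecMembership
open import Data.List.Membership.Propositional.Properties using (∈-lookup)
open import Data.List.Relation.Unary.AllPairs using (_∷_)
import Data.List.Relation.Unary.All as All
open import Data.List.Relation.Unary.Linked using (Linked; linked?)
open import Data.List.Relation.Unary.Unique.Propositional using (Unique)
import Data.List.Relation.Unary.Unique.DecPropositional as DecUnique
open import Data.Maybe.Base using (just)
import Data.Maybe.Properties as Maybe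
open import Data.Nat.Base using (ℕ; zero; suc; _+_; _/_; _≤_; z≤n; s≤s)
open import Data.Nat.Properties using (_≤?_)
open import Data.Product.Base using (∃; _×_; _,_; proj₁; proj₂)
import Data.Vec.Base as Vec
open import Function.Base using (_∘_)
open import Level using (0ℓ)
open import Relation.Binary.Core using (Rel)
import Relation.Binary.Definitions as Binary
open import Relation.Binary.PropositionalEquality.Core using (_≡_; _≢_; refl; sym; cong)
open import Relation.Nullary.Negation.Core using (contradiction)
open import Relation.Nullary.Decidable using (Dec; map′; ¬?; _×-dec_; _→-dec_)
open import Relation.Unary using (Pred; Decidable)

⌈_/3⌉ : ℕ → ℕ
⌈ m /3⌉ = (m + 2) / 3

-- Adjacency is required to be decidable so that the graph invariants below
-- are computable; classically this is no restriction.
record Graph (n : ℕ) : Set₁ where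
  infix 4 _~_ _~?_
  field
    _~_      : Rel (Fin n) 0ℓ
    ~-sym    : Binary.Symmetric _~_
    ~-irrefl : Binary.Irreflexive _≡_ _~_
    _~?_     : Binary.Decidable _~_

allSubsets : ∀ n → List (Subset n)
allSubsets zero    = Vec.[] ∷ []
allSubsets (suc n) = cartesianProductWith Vec._∷_ (inside ∷ outside ∷ []) (allSubsets n)

lookup-injective : ∀ {A : Set} {xs : List A} → Unique xs →
                   ∀ i j → lookup xs i ≡ lookup xs j → i ≡ j
lookup-injective (x≢ ∷ _) zero    zero    _  = refl
lookup-injective (x≢ ∷ _) zero    (suc j) eq = contradiction eq (All.lookup x≢ (∈-lookup j))
lookup-injective (x≢ ∷ _) (suc i) zero    eq = contradiction (sym eq) (All.lookup x≢ (∈-lookup i))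
lookup-injective (_ ∷ u)  (suc i) (suc j) eq = cong suc (lookup-injective u i j eq)

module _ {n : ℕ} (G : Graph n) where
  open Graph G

  degree : Fin n → ℕ
  degree v = length (filter (v ~?_) (allFin n))

  maxDegree : ℕ
  maxDegree = max 0 (map degree (allFin n))

  Bipartite : Set
  Bipartite = ∃ λ (side : Fin n → Bool) → ∀ {u v} → u ~ v → side u ≢ side v

  -- A path is given by the list of its vertices, both ends included.
  record IsPath (u v : Fin n) (p : List (Fin n)) : Set where
    constructor isPath
    field
      starts   : head p ≡ just u
      ends     : last p ≡ just v
      adjacent : Linked _~_ p
      distinct : Unique p

  Connected : Set
  Connected = ∀ u v → ∃ (IsPath u v)

  -- `length` counts vertices, one more than the number of edges, so it
  -- orders paths in the same way as their lengths.
  IsGeodesic : Fin n → Fin n → List (Fin n) → Set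
  IsGeodesic u v p = IsPath u v p × (∀ q → IsPath u v q → length p ≤ length q)

  IsPositionSet : Fin n → Subset n → Set
  IsPositionSet x S =
    ∀ y → y ∈ S → ∀ p → IsGeodesic x y p → ∀ z → z ∈ S → z ≢ y → z ∉ˡ p

  isPath? : ∀ u v → Decidable (IsPath u v)
  isPath? u v p =
    map′ (λ (s , e , a , d) → isPath s e a d) (λ (isPath s e a d) → s , e , a , d)
      (Maybe.≡-dec Fin._≟_ (head p) (just u)
        ×-dec Maybe.≡-dec Fin._≟_ (last p) (just v)
        ×-dec linked? _~?_ p
        ×-dec DecUnique.unique? Fin._≟_ p)

  path-length≤n : ∀ {u v p} → IsPath u v p → length p ≤ n
  path-length≤n π = Fin.injective⇒≤ (λ {i} {j} → lookup-injective (IsPath.distinct π) i j)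

  allBounded? : ∀ {ℓ} k {P : Pred (List (Fin n)) ℓ} → Decidable P →
                Dec (∀ p → length p ≤ k → P p)
  allBounded? zero P? =
    map′ (λ { P[] [] _ → P[] }) (λ f → f [] z≤n) (P? [])
  allBounded? (suc k) P? =
    map′ (λ { (P[] , _) [] _ → P[] ; (_ , P∷) (x ∷ p) (s≤s p≤k) → P∷ x p p≤k })
         (λ f → f [] z≤n , λ x p p≤k → f (x ∷ p) (s≤s p≤k))
         (P? [] ×-dec Fin.all? (λ x → allBounded? k (P? ∘ (x ∷_))))

  allPaths? : ∀ {ℓ} u v {P : Pred (List (Fin n)) ℓ} → Decidable P →
              Dec (∀ p → IsPath u v p → P p)
  allPaths? u v P? =
    map′ (λ f p π → f p (path-length≤n π) π) (λ f p _ → f p)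
         (allBounded? n (λ p → isPath? u v p →-dec P? p))

  isGeodesic? : ∀ u v → Decidable (IsGeodesic u v)
  isGeodesic? u v p = isPath? u v p ×-dec allPaths? u v (λ q → length p ≤? length q)

  isPositionSet? : ∀ x → Decidable (IsPositionSet x)
  isPositionSet? x S =
    Fin.all? λ y → (y ∈? S) →-dec
      map′ (λ f p γ → f p (proj₁ γ) γ) (λ f p _ → f p)
        (allPaths? x y λ p → isGeodesic? x y p →-dec
          Fin.all? λ z → (z ∈? S) →-dec (¬? (z Fin.≟ y) →-dec ¬? (z ∈ˡ? p)))
    where open DecMembership Fin._≟_ renaming (_∈?_ to _∈ˡ?_)

  -- The empty set is an x-position set, so the default value 0 does not
  -- affect the maximum.
  positionNumber : Fin n → ℕ
  positionNumber x = max 0 (map ∣_∣ (filter (isPositionSet? x) (allSubsets n)))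

-- A minimum over the vertices needs a vertex, hence the order `suc n`.
vp⁻ : ∀ {n} → Graph (suc n) → ℕ
vp⁻ {n} G = min (positionNumber G zero) (map (positionNumber G) (allFin (suc n)))

{-# OPTIONS --safe #-}

-- Fix a vertex x. A vertex on an x,y-geodesic other than y is strictly closer
-- to x than y is, so every distance layer of x is an x-position set. The
-- distances from x to the vertices of a closed neighbourhood N[v] differ by at
-- most one from the distance of v, so three layers cover the Δ + 1 vertices of
-- N[v]; in a bipartite graph N(v) misses the layer of v, so two layers cover
-- its Δ vertices.

module Submission where

open import Defs
open import Data.Bool.Base using (Bool; true; false; not)
open import Data.Bool.Properties using (¬-not)
open import Data.Fin.Base using (Fin; zero; suc)
import Data.Fin.Properties as Fin
open import Data.Fin.Subset
  using (Subset; inside; outside; _∈_; _⊆_; ∣_∣; _∪_; ⁅_⁆)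
open import Data.Fin.Subset.Properties
  using (p⊆q⇒∣p∣≤∣q∣; p⊂q⇒∣p∣<∣q∣; p⊆p∪q; q⊆p∪q; x∈p∪q⁻; x∈p∪q⁺; x∈⁅x⁆; x∈⁅y⁆⇒x≡y)
open import Data.List.Base using (List; []; _∷_; _∷ʳ_; length; filter; tabulate; allFin)
open import Data.List.Extrema.Nat using (max≤v⁺; max<v⁺; xs≤max; v≤min⁺)
open import Data.List.Membership.Propositional using () renaming (_∈_ to _∈ˡ_)
import Data.List.Membership.DecPropositional as DecMembership
open import Data.List.Membership.Propositional.Properties
  using (∈-map⁺; ∈-filter⁺; ∈-cartesianProductWith⁺)
open import Data.List.Properties using (length-++-comm)
open import Data.List.Relation.Unary.All using (All; []; _∷_)
import Data.List.Relation.Unary.All as All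
import Data.List.Relation.Unary.All.Properties as All
open import Data.List.Relation.Unary.AllPairs using ([]; _∷_)
open import Data.List.Relation.Unary.Any using (here; there)
open import Data.List.Relation.Unary.Linked using ([-]; _∷_)
open import Data.Nat.Base
  using (ℕ; zero; suc; pred; _+_; _*_; _≤_; _<_; z≤n; s≤s; ⌈_/2⌉)
open import Data.Nat.DivMod using (m<n*o⇒m/o<n)
open import Data.Nat.Properties
open import Data.Nat.Tactic.RingSolver using (solve-∀)
open import Data.Product.Base using (∃; _×_; _,_; proj₁; proj₂)
open import Data.Sum.Base using (_⊎_; inj₁; inj₂)
import Data.Vec.Base as Vec
open import Data.Vec.Properties using (lookup⇒[]=; []=⇒lookup; lookup∘tabulate)
open import Function.Base using (_∘_)
open import Level using (0ℓ)
open import Relation.Binary.Definitions using (tri<; tri≈; tri>)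
open import Relation.Binary.PropositionalEquality
open import Relation.Nullary.Decidable using (does; yes; no; dec-true)
open import Relation.Nullary.Negation.Core using (¬_; contradiction)
open import Relation.Unary using (Pred; Decidable)

-- Descends from `m` to the largest `k < m` satisfying `P`. When `P` is downward closed, as for
-- lower bounds of path lengths, this `k` is the greatest solution.
greatest : ∀ {P : Pred ℕ 0ℓ} → Decidable P → P 0 → ∀ m → ¬ P m →
           ∃ λ k → P k × ¬ P (suc k)
greatest P? P0 zero    ¬P0 = contradiction P0 ¬P0
greatest P? P0 (suc m) ¬Pm with P? m
... | yes Pm = m , Pm , ¬Pm
... | no ¬Pm = greatest P? P0 m ¬Pm

-- The case `m ≡ pred n` arises only from `m < n`, so the truncation of `pred` at 0 does no harm.
within-one : ∀ {m n} → m ≤ suc n → n ≤ suc m → m ≡ n ⊎ m ≡ pred n ⊎ m ≡ suc n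
within-one {m} {n} m≤1+n n≤1+m with <-cmp m n
... | tri< m<n _ _ = inj₂ (inj₁ (cong pred (≤-antisym m<n n≤1+m)))
... | tri≈ _ m≡n _ = inj₁ m≡n
... | tri> _ _ n<m = inj₂ (inj₂ (≤-antisym m≤1+n n<m))

⌈m/3⌉≤n : ∀ {m n} → m ≤ n + n + n → ⌈ m /3⌉ ≤ n
⌈m/3⌉≤n {m} {n} m≤3n = ≤-pred (m<n*o⇒m/o<n (begin-strict
  m + 2               ≤⟨ +-monoˡ-≤ 2 m≤3n ⟩
  n + n + n + 2       <⟨ n<1+n _ ⟩
  suc (n + n + n + 2) ≡⟨ solve n ⟩
  suc n * 3           ∎))
  where
  open ≤-Reasoning
  solve : ∀ n → suc (n + n + n + 2) ≡ suc n * 3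
  solve = solve-∀

⌈m/2⌉≤n : ∀ {m n} → m ≤ n + n → ⌈ m /2⌉ ≤ n
⌈m/2⌉≤n {n = n} m≤2n = ≤-trans (⌈n/2⌉-mono m≤2n) (≤-reflexive (sym (n≡⌈n+n/2⌉ n)))

comprehension : ∀ {n} {P : Pred (Fin n) 0ℓ} → Decidable P → Subset n
comprehension P? = Vec.tabulate (does ∘ P?)

module _ {n} {P : Pred (Fin n) 0ℓ} (P? : Decidable P) where

  ∈-comprehension⁺ : ∀ {y} → P y → y ∈ comprehension P?
  ∈-comprehension⁺ {y} Py =
    lookup⇒[]= y _ (trans (lookup∘tabulate _ y) (dec-true (P? y) Py))

  ∈-comprehension⁻ : ∀ {y} → y ∈ comprehension P? → P y
  ∈-comprehension⁻ {y} y∈ with P? y | trans (sym (lookup∘tabulate (does ∘ P?) y)) ([]=⇒lookup y∈)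
  ... | yes Py | _ = Py

-- Links the list count in `degree` to subset cardinality. The map `f` is arbitrary because the tail
-- of `tabulate f` is `tabulate (f ∘ suc)`.
length-filter-tabulate : ∀ {m n} {P : Pred (Fin m) 0ℓ} (P? : Decidable P) (f : Fin n → Fin m) →
                         length (filter P? (tabulate f)) ≡ ∣ Vec.tabulate (does ∘ P? ∘ f) ∣
length-filter-tabulate {n = zero}  P? f = refl
length-filter-tabulate {n = suc n} P? f with does (P? (f zero))
... | true  = cong suc (length-filter-tabulate P? (f ∘ suc))
... | false = length-filter-tabulate P? (f ∘ suc)

∣p∪q∣≤∣p∣+∣q∣ : ∀ {n} (p q : Subset n) → ∣ p ∪ q ∣ ≤ ∣ p ∣ + ∣ q ∣
∣p∪q∣≤∣p∣+∣q∣ Vec.[]            Vec.[]            = z≤n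
∣p∪q∣≤∣p∣+∣q∣ (outside Vec.∷ p) (outside Vec.∷ q) = ∣p∪q∣≤∣p∣+∣q∣ p q
∣p∪q∣≤∣p∣+∣q∣ (outside Vec.∷ p) (inside  Vec.∷ q) =
  ≤-trans (s≤s (∣p∪q∣≤∣p∣+∣q∣ p q)) (≤-reflexive (sym (+-suc ∣ p ∣ ∣ q ∣)))
∣p∪q∣≤∣p∣+∣q∣ (inside  Vec.∷ p) (outside Vec.∷ q) = s≤s (∣p∪q∣≤∣p∣+∣q∣ p q)
∣p∪q∣≤∣p∣+∣q∣ (inside  Vec.∷ p) (inside  Vec.∷ q) =
  s≤s (≤-trans (∣p∪q∣≤∣p∣+∣q∣ p q) (+-monoʳ-≤ ∣ p ∣ (n≤1+n ∣ q ∣)))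

∈-allSubsets : ∀ {n} (S : Subset n) → S ∈ˡ allSubsets n
∈-allSubsets Vec.[] = here refl
∈-allSubsets (inside  Vec.∷ S) =
  ∈-cartesianProductWith⁺ Vec._∷_ {xs = inside ∷ outside ∷ []} (here refl) (∈-allSubsets S)
∈-allSubsets (outside Vec.∷ S) =
  ∈-cartesianProductWith⁺ Vec._∷_ {xs = inside ∷ outside ∷ []} (there (here refl)) (∈-allSubsets S)

module _ {n : ℕ} (G : Graph n) where
  open Graph G
  open DecMembership (Fin._≟_ {n}) using () renaming (_∈?_ to _∈ˡ?_)

  ∷-isPath : ∀ {a b v q} → a ~ b → All (a ≢_) q → IsPath G b v q → IsPath G a v (a ∷ q)
  ∷-isPath {q = _ ∷ _} a~b a∉q (isPath refl e l d) = isPath refl e (a~b ∷ l) (a∉q ∷ d)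

  -- Cuts `p` at `z`. The last component says that the vertices of the prefix come from `p`; the
  -- induction uses it to keep the first vertex `a` fresh.
  prefix : ∀ {u v z} p → IsPath G u v p → z ∈ˡ p →
           ∃ λ q → IsPath G u z q × length q ≤ length p × (z ≢ v → length q < length p) ×
                   (∀ {P : Pred (Fin n) 0ℓ} → All P p → All P q)
  prefix {z = z} (_ ∷ []) (isPath refl refl _ _) (here refl) =
    z ∷ [] , isPath refl refl [-] ([] ∷ []) , ≤-refl , (λ z≢z → contradiction refl z≢z) , λ ps → ps
  prefix {z = z} (_ ∷ _ ∷ _) (isPath refl _ _ _) (here refl) =
    z ∷ [] , isPath refl refl [-] ([] ∷ []) , s≤s z≤n , (λ _ → s≤s (s≤s z≤n)) , λ { (p ∷ _) → p ∷ [] }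
  prefix (a ∷ as@(_ ∷ _)) (isPath refl e (a~b ∷ l) (a∉ ∷ d)) (there z∈as)
    with q , π , ≤p , <p , all ← prefix as (isPath refl e l d) z∈as =
    a ∷ q , ∷-isPath a~b (all a∉) π , s≤s ≤p , (λ z≢v → s≤s (<p z≢v)) , λ { (p ∷ ps) → p ∷ all ps }

  ∷ʳ-isPath : ∀ {u v w} p → IsPath G u v p → v ~ w → All (_≢ w) p → IsPath G u w (p ∷ʳ w)
  ∷ʳ-isPath (a ∷ []) (isPath refl refl _ _) v~w (a≢w ∷ []) =
    isPath refl refl (v~w ∷ [-]) ((a≢w ∷ []) ∷ [] ∷ [])
  ∷ʳ-isPath (a ∷ as@(_ ∷ _)) (isPath refl e (a~b ∷ l) (a∉ ∷ d)) v~w (a≢w ∷ w∉) =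
    ∷-isPath a~b (All.∷ʳ⁺ a∉ a≢w) (∷ʳ-isPath as (isPath refl e l d) v~w w∉)

  extend : ∀ {u v w} p → IsPath G u v p → v ~ w →
           ∃ λ q → IsPath G u w q × length q ≤ suc (length p)
  extend {w = w} p π v~w with w ∈ˡ? p
  -- Appending `w` would repeat a vertex, so the part of `p` up to `w` is taken instead.
  ... | yes w∈p with q , ρ , ≤p , _ ← prefix p π w∈p = q , ρ , m≤n⇒m≤1+n ≤p
  ... | no  w∉p =
    p ∷ʳ w , ∷ʳ-isPath p π v~w (All.tabulate λ { a∈p refl → w∉p a∈p }) ,
    ≤-reflexive (length-++-comm p (w ∷ []))

  -- Every edge flips the side, so the side of the end is determined by the side of the start and
  -- the number of vertices.
  ends-same-side : ∀ {side : Fin n → Bool} → (∀ {u v} → u ~ v → side u ≢ side v) →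
                   ∀ {u v u′ v′} p q → IsPath G u v p → IsPath G u′ v′ q →
                   length p ≡ length q → side u ≡ side u′ → side v ≡ side v′
  ends-same-side bip (_ ∷ []) (_ ∷ []) (isPath refl refl _ _) (isPath refl refl _ _) _ eq = eq
  ends-same-side bip (_ ∷ p@(_ ∷ _)) (_ ∷ q@(_ ∷ _))
      (isPath refl e (a~b ∷ l) (_ ∷ d)) (isPath refl e′ (a~b′ ∷ l′) (_ ∷ d′)) len eq =
    ends-same-side bip p q (isPath refl e l d) (isPath refl e′ l′ d′) (suc-injective len)
      (trans (¬-not (bip (~-sym a~b))) (trans (cong not eq) (sym (¬-not (bip (~-sym a~b′))))))

  ∣positionSet∣≤ : ∀ {x S} → IsPositionSet G x S → ∣ S ∣ ≤ positionNumber G x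
  ∣positionSet∣≤ {x} {S} pos = All.lookup (xs≤max 0 _)
    (∈-map⁺ ∣_∣ (∈-filter⁺ (isPositionSet? G x) (∈-allSubsets S) pos))

  neighbours : Fin n → Subset n
  neighbours v = comprehension (v ~?_)

  degree≡∣neighbours∣ : ∀ v → degree G v ≡ ∣ neighbours v ∣
  degree≡∣neighbours∣ v = length-filter-tabulate (v ~?_) (λ w → w)

  -- By irreflexivity `v` is not among its neighbours, so the inclusion is proper.
  degree<∣closedNeighbourhood∣ : ∀ v → degree G v < ∣ ⁅ v ⁆ ∪ neighbours v ∣
  degree<∣closedNeighbourhood∣ v = subst (_< ∣ ⁅ v ⁆ ∪ neighbours v ∣) (sym (degree≡∣neighbours∣ v))
    (p⊂q⇒∣p∣<∣q∣ (q⊆p∪q ⁅ v ⁆ (neighbours v) , v , p⊆p∪q (neighbours v) (x∈⁅x⁆ v) ,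
      λ v∈N → ~-irrefl refl (∈-comprehension⁻ (v ~?_) v∈N)))

  module _ (connected : Connected G) (x : Fin n) where

    -- Distances are counted in vertices, so that dist x ≡ 1. Taking the
    -- greatest lower bound of the path lengths avoids constructing a geodesic.
    distance : ∀ y → ∃ λ k → (∀ p → IsPath G x y p → k ≤ length p)
                           × ¬ (∀ p → IsPath G x y p → k < length p)
    distance y = greatest (λ k → allPaths? G x y (λ p → k ≤? length p)) (λ _ _ → z≤n)
      (suc (length (proj₁ (connected x y)))) (λ f → 1+n≰n (f _ (proj₂ (connected x y))))

    dist : Fin n → ℕ
    dist y = proj₁ (distance y)

    dist≤length : ∀ {y p} → IsPath G x y p → dist y ≤ length p
    dist≤length {y} = proj₁ (proj₂ (distance y)) _

    -- If every path length differed from `dist y`, then `suc (dist y)` would still be a lower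
    -- bound. This negative form suffices for proving contradictions.
    dist-attained : ∀ {y} → ¬ (∀ p → IsPath G x y p → dist y ≢ length p)
    dist-attained {y} ≢length =
      proj₂ (proj₂ (distance y)) λ p π → ≤∧≢⇒< (dist≤length π) (≢length p π)

    dist-greatest : ∀ {k y} → (∀ p → IsPath G x y p → k ≤ length p) → k ≤ dist y
    dist-greatest {y = y} k≤ =
      ≮⇒≥ λ d<k → proj₂ (proj₂ (distance y)) λ p π → ≤-trans d<k (k≤ p π)

    -- Each x,v-path extends to an x,w-path with at most one more vertex, so `pred (dist w)` bounds
    -- all x,v-path lengths from below.
    dist-~ : ∀ {v w} → v ~ w → dist w ≤ suc (dist v)
    dist-~ {w = w} v~w = ≤-trans (suc-pred-≤ (dist w)) (s≤s (dist-greatest λ p π →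
      let _ , ρ , q≤ = extend p π v~w in pred-mono-≤ (≤-trans (dist≤length ρ) q≤)))
      where
      suc-pred-≤ : ∀ m → m ≤ suc (pred m)
      suc-pred-≤ zero    = z≤n
      suc-pred-≤ (suc m) = ≤-refl

    -- The prefix of `p` ending at `z` is strictly shorter than `p`, and the length of a geodesic is
    -- itself a lower bound, hence at most `dist y`.
    dist-geodesic : ∀ {y p z} → IsGeodesic G x y p → z ∈ˡ p → z ≢ y → dist z < dist y
    dist-geodesic {p = p} (π , shortest) z∈p z≢y =
      let _ , ρ , _ , q<p , _ = prefix p π z∈p
      in ≤-<-trans (dist≤length ρ) (<-≤-trans (q<p z≢y) (dist-greatest shortest))

    dist-bipartite : Bipartite G → ∀ {v w} → v ~ w → dist v ≢ dist w
    dist-bipartite (side , bip) v~w dv≡dw =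
      -- Equal distances would give paths from `x` to `v` and to `w` with equally many vertices,
      -- putting `v` and `w` on the same side.
      dist-attained λ p π dv≡p → dist-attained λ q ρ dw≡q →
        bip v~w (ends-same-side bip p q π ρ (trans (sym dv≡p) (trans dv≡dw dw≡q)) refl)

    layer : ℕ → Subset n
    layer k = comprehension (λ y → dist y ≟ k)

    ∈-layer : ∀ {k y} → dist y ≡ k → y ∈ layer k
    ∈-layer = ∈-comprehension⁺ (λ y → dist y ≟ _)

    ∣layer∣≤ : ∀ k → ∣ layer k ∣ ≤ positionNumber G x
    ∣layer∣≤ k = ∣positionSet∣≤ λ y y∈L p γ z z∈L z≢y z∈p →
      <⇒≢ (dist-geodesic γ z∈p z≢y) (trans (dist∈ z∈L) (sym (dist∈ y∈L)))
      where
      dist∈ : ∀ {y} → y ∈ layer k → dist y ≡ k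
      dist∈ = ∈-comprehension⁻ (λ y → dist y ≟ k)

    -- For `v ≡ x` the lower layer is `layer 0`, which is empty because every path has at least one
    -- vertex.
    sideLayers : Fin n → Subset n
    sideLayers v = layer (pred (dist v)) ∪ layer (suc (dist v))

    ∣sideLayers∣≤ : ∀ v → ∣ sideLayers v ∣ ≤ positionNumber G x + positionNumber G x
    ∣sideLayers∣≤ v =
      ≤-trans (∣p∪q∣≤∣p∣+∣q∣ (layer (pred (dist v))) (layer (suc (dist v))))
              (+-mono-≤ (∣layer∣≤ _) (∣layer∣≤ _))

    neighbour-layer : ∀ {v w} → v ~ w → dist w ≡ dist v ⊎ w ∈ sideLayers v
    neighbour-layer v~w with within-one (dist-~ v~w) (dist-~ (~-sym v~w))
    ... | inj₁ eq        = inj₁ eq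
    ... | inj₂ (inj₁ eq) = inj₂ (x∈p∪q⁺ (inj₁ (∈-layer eq)))
    ... | inj₂ (inj₂ eq) = inj₂ (x∈p∪q⁺ (inj₂ (∈-layer eq)))

    degree<3p : ∀ v → degree G v < positionNumber G x + positionNumber G x + positionNumber G x
    degree<3p v = begin-strict
      degree G v                                <⟨ degree<∣closedNeighbourhood∣ v ⟩
      ∣ ⁅ v ⁆ ∪ neighbours v ∣                  ≤⟨ p⊆q⇒∣p∣≤∣q∣ cover ⟩
      ∣ sideLayers v ∪ layer (dist v) ∣         ≤⟨ ∣p∪q∣≤∣p∣+∣q∣ (sideLayers v) (layer (dist v)) ⟩
      ∣ sideLayers v ∣ + ∣ layer (dist v) ∣     ≤⟨ +-mono-≤ (∣sideLayers∣≤ v) (∣layer∣≤ _) ⟩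
      positionNumber G x + positionNumber G x + positionNumber G x ∎
      where
      open ≤-Reasoning
      cover : ⁅ v ⁆ ∪ neighbours v ⊆ sideLayers v ∪ layer (dist v)
      cover w∈ with x∈p∪q⁻ ⁅ v ⁆ (neighbours v) w∈
      ... | inj₁ w∈v = x∈p∪q⁺ (inj₂ (∈-layer (cong dist (x∈⁅y⁆⇒x≡y v w∈v))))
      ... | inj₂ w∈N with neighbour-layer (∈-comprehension⁻ (v ~?_) w∈N)
      ...   | inj₁ eq = x∈p∪q⁺ (inj₂ (∈-layer eq))
      ...   | inj₂ w∈ = x∈p∪q⁺ (inj₁ w∈)

    degree≤2p : Bipartite G → ∀ v → degree G v ≤ positionNumber G x + positionNumber G x
    degree≤2p bip v = subst (_≤ _) (sym (degree≡∣neighbours∣ v))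
      (≤-trans (p⊆q⇒∣p∣≤∣q∣ cover) (∣sideLayers∣≤ v))
      where
      cover : neighbours v ⊆ sideLayers v
      cover w∈N with v~w ← ∈-comprehension⁻ (v ~?_) w∈N | neighbour-layer v~w
      ... | inj₁ eq = contradiction (sym eq) (dist-bipartite bip v~w)
      ... | inj₂ w∈ = w∈

-- The minimum starts from the value at `zero`, so the bound is supplied there as well as on the
-- list.
≤vp⁻ : ∀ {n} (G : Graph (suc n)) {k} → (∀ x → k ≤ positionNumber G x) → k ≤ vp⁻ G
≤vp⁻ {n} G k≤ = v≤min⁺ (k≤ zero) (All.map⁺ {xs = allFin (suc n)} (All.tabulate λ {x} _ → k≤ x))

theorem2p9 : ∀ {n : ℕ} (G : Graph (suc n)) → Connected G →
    (⌈ maxDegree G + 1 /3⌉ ≤ vp⁻ G) × (Bipartite G → ⌈ maxDegree G /2⌉ ≤ vp⁻ G)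
theorem2p9 G connected =
  ≤vp⁻ G (λ x → ⌈m/3⌉≤n (≤-trans (≤-reflexive (+-comm (maxDegree G) 1))
    -- The maximum has default 0, so a strict bound on it also requires `0 < 3p`; this follows from
    -- the degree of `zero`.
    (max<v⁺ (≤-<-trans z≤n (degree<3p G connected x zero))
      (All.map⁺ {xs = allFin _} (All.tabulate λ {v} _ → degree<3p G connected x v))))) ,
  λ bip → ≤vp⁻ G λ x → ⌈m/2⌉≤n
    (max≤v⁺ z≤n (All.map⁺ {xs = allFin _} (All.tabulate λ {v} _ → degree≤2p G connected x bip v)))
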